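{- Let $r_1,\ldots,r_m$ and $c_1,\ldots,c_n$ be positive integers such that $r_1+\cdots+r_m=c_1+\cdots+c_n=N$, and let $W=(w_{ij})$ be a non-negative $m\times n$ matrix. Construct an $N\times N$ matrix $A$ as follows. Represent the set of rows of $A$ as a disjoint union of $m$ subsets $R_1,\ldots,R_m$ with $|R_i|=r_i$ for $i=1,\ldots,m$, and the set of columns of $A$ as a disjoint union of $n$ subsets $C_1,\ldots,C_n$ with $|C_j|=c_j$ for $j=1,\ldots,n$, so that $A$ is split into $mn$ blocks $R_i\times C_j$. Let every entry of $A$ in the block $R_i\times C_j$ be equal to $w_{ij}$. Then the total weight of the $m\times n$ contingency tables with row sums $r_1,\ldots,r_m$ and column sums $c_1,\ldots,c_n$, where the table $D=(d_{ij})$ is counted with the weight $$\prod_{i,j}\frac{w_{ij}^{d_{ij}}}{d_{ij}!},$$ is equal to $$\frac{\operatorname{per}A}{r_1!\cdots r_m!\,c_1!\cdots c_n!}.$$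
   Context: An $m\times n$ contingency table with row sums $r_1,\ldots,r_m$ and column sums $c_1,\ldots,c_n$ is an $m\times n$ matrix with non-negative integer entries having these row and column sums. The permanent of an $N\times N$ matrix $A=(a_{ij})$ is $\operatorname{per}A=\sum_{\sigma\in S_N}\prod_{i=1}^N a_{i\sigma(i)}$, where $S_N$ is the symmetric group on $\{1,\ldots,N\}$. The convention $0^0=1$ is used. -}

module Defs where

open import Algebra.Apartness.Bundles using (HeytingField; HeytingCommutativeRing)
open import Algebra.Bundles using (CommutativeRing; Semiring)
import Algebra.Definitions.RawSemiring as RawSemiringDefs
import Algebra.Properties.CommutativeMonoid.Sum as MonoidSum
import Algebra.Properties.Ring as RingProperties
open import Data.Fin.Base using (Fin; zero; suc; toℕ; fromℕ<; punchIn; combine; remQuot; finToFun; funToFin)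
open import Data.Fin.Permutation as Perm using (Permutation′; _⟨$⟩ʳ_; insert; remove)
open import Data.Fin.Properties
  using (toℕ-fromℕ<; fromℕ<-toℕ; fromℕ<-cong; all?; combine-remQuot; remQuot-combine; finToFun-funToFin; funToFin-finToFin;
         punchIn-injective)
open import Data.Fin.Subset using (Subset; _∈_; _∩_; Empty)
open import Data.Nat.Base as ℕ using (ℕ; zero; suc; NonZero; _!)
import Data.Nat.Properties as ℕ
open import Data.Product.Base using (Σ; ∃; _×_; _,_; proj₁; proj₂)
open import Data.Sum.Base using (_⊎_; inj₁; inj₂)
open import Function.Base using (_∘_)
open import Function.Bundles using (Inverse; module Inverse)
import Function.Construct.Composition as Composition
open import Level using (Level; _⊔_) renaming (suc to lsuc)
open import Relation.Binary.Bundles using (Setoid)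
open import Relation.Binary.Core using (Rel)
import Relation.Binary.Construct.On as On
open import Relation.Binary.PropositionalEquality as ≡ using (_≡_; _≢_; refl)
open import Relation.Binary.Structures using (IsStrictPartialOrder)
open import Relation.Nullary using (¬_; yes; no; contradiction)
open import Relation.Nullary.Decidable using (_×-dec_)
open import Relation.Unary using (Pred; Decidable)

private
  variable
    a ℓ : Level
    k m n N : ℕ

-- The library has no real numbers; entries are taken from an arbitrary ordered
-- field in the constructive sense, of which the reals are an instance.
-- Apartness means strict inequality in one of the two directions, and the weak
-- order is the negation of the reversed strict order.

record OrderedField c ℓ₁ ℓ₂ ℓ₃ : Set (lsuc (c ⊔ ℓ₁ ⊔ ℓ₂ ⊔ ℓ₃)) where
  infix 4 _<_ _≤_
  field
    heytingField : HeytingField c ℓ₁ ℓ₂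

  open HeytingField heytingField public
  open HeytingCommutativeRing heytingCommutativeRing public
    using (commutativeRing)
  open CommutativeRing commutativeRing public
    using (semiring; ring)
  open Semiring semiring public
    using (rawSemiring)

  field
    _<_                    : Rel Carrier ℓ₃
    <-isStrictPartialOrder : IsStrictPartialOrder _≈_ _<_
    #⇒<⊎>                  : ∀ {x y} → x # y → x < y ⊎ y < x
    <⇒#                    : ∀ {x y} → x < y → x # y
    +-monoˡ-<              : ∀ z {x y} → x < y → x + z < y + z
    *-pos                  : ∀ {x y} → 0# < x → 0# < y → 0# < x * y

  _≤_ : Rel Carrier ℓ₃
  x ≤ y = ¬ (y < x)

  open RawSemiringDefs rawSemiring public
    using (sum; product; _^_)
    renaming (_×_ to _·_)

  -- The image of a natural number in the field.
  fromℕ : ℕ → Carrier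
  fromℕ n = n · 1#

  private
    module O = IsStrictPartialOrder <-isStrictPartialOrder
    module P = RingProperties ring
    module S = Setoid setoid

    0<1 : 0# < 1#
    0<1 with #⇒<⊎> (invertible⇒# (1# , 1*[1-0]≈1 , S.trans (*-comm _ _) 1*[1-0]≈1))
      where
      1*[1-0]≈1 : 1# * (1# - 0#) ≈ 1#
      1*[1-0]≈1 = S.trans (*-identityˡ _) (S.trans (+-congˡ P.-0#≈0#) (+-identityʳ 1#))
    ... | inj₂ 0<1 = 0<1
    ... | inj₁ 1<0 = O.<-respʳ-≈ -1*-1≈1 (*-pos 0<-1 0<-1)
      where
      0<-1 : 0# < - 1#
      0<-1 = O.<-respʳ-≈ (+-identityˡ _) (O.<-respˡ-≈ (-‿inverseʳ 1#) (+-monoˡ-< (- 1#) 1<0))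
      -1*-1≈1 : - 1# * - 1# ≈ 1#
      -1*-1≈1 = S.trans (P.-1*x≈-x (- 1#)) (P.-‿involutive 1#)

    fromℕ-pos : ∀ n → 0# < fromℕ (suc n)
    fromℕ-pos zero    = O.<-respʳ-≈ (S.sym (+-identityʳ 1#)) 0<1
    fromℕ-pos (suc n) =
      O.trans (fromℕ-pos n)
        (O.<-respʳ-≈ S.refl (O.<-respˡ-≈ (+-identityˡ _) (+-monoˡ-< (fromℕ (suc n)) 0<1)))

  -- The multiplicative inverse of fromℕ n; the field provides inverses of
  -- differences x - y with x # y, applied here to fromℕ n - 0#.
  recip : ∀ n → .{{NonZero n}} → Carrier
  recip (suc n) = proj₁ (#⇒invertible (#-sym (<⇒# (fromℕ-pos n))))

  fromℕ*recip≈1 : ∀ n .{{_ : NonZero n}} → fromℕ n * recip n ≈ 1#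
  fromℕ*recip≈1 (suc n) =
    S.trans (*-congʳ (S.sym (S.trans (+-congˡ P.-0#≈0#) (+-identityʳ _))))
            (proj₂ (proj₂ (#⇒invertible (#-sym (<⇒# (fromℕ-pos n))))))

  infixl 7 _/ℕ_
  _/ℕ_ : Carrier → ∀ n → .{{NonZero n}} → Carrier
  x /ℕ n = x * recip n

open RawSemiringDefs ℕ.+-*-rawSemiring public
  using () renaming (sum to sumℕ; product to productℕ)

-- r₁! ⋯ rₘ!
factorials : (Fin m → ℕ) → ℕ
factorials r = productℕ (λ i → r i !)

factorials≢0 : (r : Fin m → ℕ) → NonZero (factorials r)
factorials≢0 {m = zero}  r = _
factorials≢0 {m = suc m} r =
  ℕ.m*n≢0 (r zero !) (factorials (r ∘ suc)) {{r zero ℕ.!≢0}} {{factorials≢0 (r ∘ suc)}}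

factorials*factorials≢0 : (r : Fin m → ℕ) (c : Fin n → ℕ) →
                          NonZero (factorials r ℕ.* factorials c)
factorials*factorials≢0 r c =
  ℕ.m*n≢0 (factorials r) (factorials c) {{factorials≢0 r}} {{factorials≢0 c}}

record IsDisjointUnion (P : Fin k → Subset N) : Set where
  field
    disjoint : ∀ {i j} → i ≢ j → Empty (P i ∩ P j)
    covers   : ∀ x → ∃ λ i → x ∈ P i

record Finite (S : Setoid a ℓ) : Set (a ⊔ ℓ) where
  field
    card        : ℕ
    enumeration : Inverse (≡.setoid (Fin card)) S

  element : Fin card → Setoid.Carrier S
  element = Inverse.to enumeration

permutationSetoid : ℕ → Setoid _ _
permutationSetoid N = record
  { Carrier       = Permutation′ N
  ; _≈_           = Perm._≈_
  ; isEquivalence = record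
    { refl  = λ _ → refl
    ; sym   = λ p i → ≡.sym (p i)
    ; trans = λ p q i → ≡.trans (p i) (q i)
    }
  }

matrixSetoid : ℕ → ℕ → Setoid _ _
matrixSetoid m n = record
  { Carrier       = Fin m → Fin n → ℕ
  ; _≈_           = λ D E → ∀ i j → D i j ≡ E i j
  ; isEquivalence = record
    { refl  = λ _ _ → refl
    ; sym   = λ p i j → ≡.sym (p i j)
    ; trans = λ p q i j → ≡.trans (p i j) (q i j)
    }
  }

IsContingencyTable : (Fin m → ℕ) → (Fin n → ℕ) → (Fin m → Fin n → ℕ) → Set
IsContingencyTable r c D =
  (∀ i → sumℕ (λ j → D i j) ≡ r i) × (∀ j → sumℕ (λ i → D i j) ≡ c j)

ContingencyTable : (Fin m → ℕ) → (Fin n → ℕ) → Set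
ContingencyTable r c = Σ _ (IsContingencyTable r c)

tableSetoid : (Fin m → ℕ) → (Fin n → ℕ) → Setoid _ _
tableSetoid {m} {n} r c = On.setoid {B = ContingencyTable r c} (matrixSetoid m n) proj₁

-- There are N! permutations; one of {0,…,N} is determined by the image of 0
-- and the permutation that remains after removing 0.

private
  insert-cong : ∀ j {π ρ : Permutation′ N} → π Perm.≈ ρ → insert zero j π Perm.≈ insert zero j ρ
  insert-cong j p zero    = refl
  insert-cong j p (suc i) = ≡.cong (punchIn j) (p i)

  remove-cong : {π ρ : Permutation′ (suc N)} → π Perm.≈ ρ → remove zero π Perm.≈ remove zero ρ
  remove-cong {π = π} {ρ = ρ} p i = punchIn-injective (ρ ⟨$⟩ʳ zero) _ _ (begin
    punchIn (ρ ⟨$⟩ʳ zero) (remove zero π ⟨$⟩ʳ i)  ≡⟨ ≡.cong (λ z → punchIn z (remove zero π ⟨$⟩ʳ i)) (≡.sym (p zero)) ⟩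
    punchIn (π ⟨$⟩ʳ zero) (remove zero π ⟨$⟩ʳ i)  ≡⟨ ≡.sym (Perm.punchIn-permute π zero i) ⟩
    π ⟨$⟩ʳ suc i                                  ≡⟨ p (suc i) ⟩
    ρ ⟨$⟩ʳ suc i                                  ≡⟨ Perm.punchIn-permute ρ zero i ⟩
    punchIn (ρ ⟨$⟩ʳ zero) (remove zero ρ ⟨$⟩ʳ i)  ∎)
    where
    open ≡.≡-Reasoning

  decodePerm : ∀ N → Fin (N !) → Permutation′ N
  decodePerm zero    _ = Perm.id
  decodePerm (suc N) k = insert zero (proj₁ (remQuot {suc N} (N !) k)) (decodePerm N (proj₂ (remQuot {suc N} (N !) k)))

  encodePerm : ∀ N → Permutation′ N → Fin (N !)
  encodePerm zero    _ = zero
  encodePerm (suc N) π = combine (π ⟨$⟩ʳ zero) (encodePerm N (remove zero π))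

  encodePerm-cong : ∀ N {π ρ : Permutation′ N} → π Perm.≈ ρ → encodePerm N π ≡ encodePerm N ρ
  encodePerm-cong zero    _ = refl
  encodePerm-cong (suc N) {π} {ρ} p =
    ≡.cong₂ combine (p zero) (encodePerm-cong N (remove-cong {π = π} {ρ} p))

  decode-encodePerm : ∀ N (π : Permutation′ N) → decodePerm N (encodePerm N π) Perm.≈ π
  decode-encodePerm zero    π ()
  decode-encodePerm (suc N) π i = begin
    insert zero (proj₁ (remQuot {suc N} (N !) code)) (decodePerm N (proj₂ (remQuot {suc N} (N !) code))) ⟨$⟩ʳ i
      ≡⟨ ≡.cong (λ x → insert zero (proj₁ x) (decodePerm N (proj₂ x)) ⟨$⟩ʳ i)
           (remQuot-combine {suc N} {(N !)} (π ⟨$⟩ʳ zero) (encodePerm N ρ)) ⟩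
    insert zero (π ⟨$⟩ʳ zero) (decodePerm N (encodePerm N ρ)) ⟨$⟩ʳ i
      ≡⟨ insert-cong (π ⟨$⟩ʳ zero) {decodePerm N (encodePerm N ρ)} {ρ} (decode-encodePerm N ρ) i ⟩
    insert zero (π ⟨$⟩ʳ zero) ρ ⟨$⟩ʳ i
      ≡⟨ Perm.insert-remove zero π i ⟩
    π ⟨$⟩ʳ i ∎
    where
    open ≡.≡-Reasoning
    ρ = remove zero π
    code = encodePerm (suc N) π

  encode-decodePerm : ∀ N (k : Fin (N !)) → encodePerm N (decodePerm N k) ≡ k
  encode-decodePerm zero    zero = refl
  encode-decodePerm (suc N) k =
    ≡.trans
      (≡.cong (combine q) (≡.trans
        (encodePerm-cong N {remove zero (insert zero q π)} {π} (Perm.remove-insert zero q π))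
        (encode-decodePerm N s)))
      (combine-remQuot {suc N} (N !) k)
    where
    q = proj₁ (remQuot {suc N} (N !) k)
    s = proj₂ (remQuot {suc N} (N !) k)
    π = decodePerm N s

permutations : ∀ N → Finite (permutationSetoid N)
permutations N = record
  { card        = N !
  ; enumeration = record
    { to        = decodePerm N
    ; from      = encodePerm N
    ; to-cong   = λ { refl _ → refl }
    ; from-cong = λ {π} {ρ} → encodePerm-cong N {π} {ρ}
    ; inverse   = (λ { {π} refl → decode-encodePerm N π })
                , (λ {k} {π} p → ≡.trans (encodePerm-cong N {π} {decodePerm N k} p) (encode-decodePerm N k))
    }
  }

-- The entries of a contingency table are at most r₁ + ⋯ + rₘ, so the tables
-- are found among finitely many matrices by testing the margins.

private
  filterFin : ∀ k {P : Pred (Fin k) a} → Decidable P →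
              Finite (On.setoid {B = Σ (Fin k) P} (≡.setoid (Fin k)) proj₁)
  filterFin zero P? = record
    { card        = 0
    ; enumeration = record
      { to        = λ ()
      ; from      = λ { (() , _) }
      ; to-cong   = λ { {()} }
      ; from-cong = λ { {() , _} }
      ; inverse   = (λ { {() , _} }) , (λ { {()} })
      }
    }
  filterFin (suc k) {P} P? with filterFin k (P? ∘ suc) | P? zero
  ... | rec | yes p = record
    { card        = suc (Finite.card rec)
    ; enumeration = record
      { to        = to
      ; from      = from
      ; to-cong   = λ { refl → refl }
      ; from-cong = from-cong
      ; inverse   = (λ { {x} refl → to-from x })
                  , (λ {x} {y} e → ≡.trans (from-cong {y} {to x} e) (from-to x))
      }
    }
    where
    module R = Inverse (Finite.enumeration rec)
    to : Fin (suc (Finite.card rec)) → Σ (Fin (suc k)) P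
    to zero    = zero , p
    to (suc i) = suc (proj₁ (R.to i)) , proj₂ (R.to i)
    from : Σ (Fin (suc k)) P → Fin (suc (Finite.card rec))
    from (zero  , _) = zero
    from (suc x , q) = suc (R.from (x , q))
    from-cong : ∀ {x y} → proj₁ x ≡ proj₁ y → from x ≡ from y
    from-cong {zero  , _} {zero  , _} refl = refl
    from-cong {suc x , _} {suc x , _} refl = ≡.cong suc (R.from-cong refl)
    to-from : ∀ x → proj₁ (to (from x)) ≡ proj₁ x
    to-from (zero  , _) = refl
    to-from (suc x , q) = ≡.cong suc (R.inverseˡ refl)
    from-to : ∀ i → from (to i) ≡ i
    from-to zero    = refl
    from-to (suc i) = ≡.cong suc (R.inverseʳ refl)
  ... | rec | no ¬p = record
    { card        = Finite.card rec
    ; enumeration = record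
      { to        = to
      ; from      = from
      ; to-cong   = λ { refl → refl }
      ; from-cong = from-cong
      ; inverse   = (λ { {x} refl → to-from x })
                  , (λ {x} {y} e → ≡.trans (from-cong {y} {to x} e) (R.inverseʳ refl))
      }
    }
    where
    module R = Inverse (Finite.enumeration rec)
    to : Fin (Finite.card rec) → Σ (Fin (suc k)) P
    to i = suc (proj₁ (R.to i)) , proj₂ (R.to i)
    from : Σ (Fin (suc k)) P → Fin (Finite.card rec)
    from (zero  , p) = contradiction p ¬p
    from (suc x , q) = R.from (x , q)
    from-cong : ∀ {x y} → proj₁ x ≡ proj₁ y → from x ≡ from y
    from-cong {zero  , p} = contradiction p ¬p
    from-cong {suc x , _} {suc x , _} refl = R.from-cong refl
    to-from : ∀ x → proj₁ (to (from x)) ≡ proj₁ x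
    to-from (zero  , p) = contradiction p ¬p
    to-from (suc x , q) = ≡.cong suc (R.inverseˡ refl)

  open MonoidSum ℕ.+-0-commutativeMonoid using (sum-cong-≗)

  entry≤sum : (f : Fin n → ℕ) → ∀ i → f i ℕ.≤ sumℕ f
  entry≤sum f zero    = ℕ.m≤m+n _ _
  entry≤sum f (suc i) = ℕ.≤-trans (entry≤sum (f ∘ suc) i) (ℕ.m≤n+m _ (f zero))

  funToFin-cong : ∀ {m n} {f g : Fin m → Fin n} → (∀ i → f i ≡ g i) → funToFin f ≡ funToFin g
  funToFin-cong {zero}  p = refl
  funToFin-cong {suc m} p = ≡.cong₂ combine (p zero) (funToFin-cong (p ∘ suc))

  module Enumerate {m n} (r : Fin m → ℕ) (c : Fin n → ℕ) where
    B codes : ℕ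
    B     = suc (sumℕ r)
    codes = (B ℕ.^ n) ℕ.^ m

    decodeFin : Fin codes → Fin m → Fin n → Fin B
    decodeFin k i = finToFun (finToFun {B ℕ.^ n} {m} k i)

    encodeFin : (Fin m → Fin n → Fin B) → Fin codes
    encodeFin M = funToFin (λ i → funToFin (M i))

    decode : Fin codes → Fin m → Fin n → ℕ
    decode k i j = toℕ (decodeFin k i j)

    encodeFin-cong : ∀ {M M′} → (∀ i j → M i j ≡ M′ i j) → encodeFin M ≡ encodeFin M′
    encodeFin-cong p = funToFin-cong (λ i → funToFin-cong (p i))

    decode-encodeFin : ∀ M i j → decodeFin (encodeFin M) i j ≡ M i j
    decode-encodeFin M i j = ≡.trans
      (≡.cong (λ x → finToFun x j) (finToFun-funToFin (λ i → funToFin (M i)) i))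
      (finToFun-funToFin (M i) j)

    encode-decodeFin : ∀ k → encodeFin (decodeFin k) ≡ k
    encode-decodeFin k = ≡.trans
      (funToFin-cong (λ i → funToFin-finToFin {n} {B} (finToFun {B ℕ.^ n} {m} k i)))
      (funToFin-finToFin {m} {B ℕ.^ n} k)

    IsCode : Fin codes → Set
    IsCode k = IsContingencyTable r c (decode k)

    isCode? : Decidable IsCode
    isCode? k = all? (λ _ → _ ℕ.≟ _) ×-dec all? (λ _ → _ ℕ.≟ _)

    bound : (D : ContingencyTable r c) → ∀ i j → proj₁ D i j ℕ.< B
    bound (D , rows , _) i j = ℕ.s≤s (ℕ.≤-trans (entry≤sum (D i) j)
      (ℕ.≤-trans (ℕ.≤-reflexive (rows i)) (entry≤sum r i)))

    encode : ContingencyTable r c → Fin codes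
    encode D = encodeFin (λ i j → fromℕ< (bound D i j))

    decode-encode : ∀ D i j → decode (encode D) i j ≡ proj₁ D i j
    decode-encode D i j = ≡.trans
      (≡.cong toℕ (decode-encodeFin (λ i j → fromℕ< (bound D i j)) i j))
      (toℕ-fromℕ< (bound D i j))

    encode-cong : ∀ D E → (∀ i j → proj₁ D i j ≡ proj₁ E i j) → encode D ≡ encode E
    encode-cong D E p = encodeFin-cong (λ i j → fromℕ<-cong _ _ (p i j) (bound D i j) (bound E i j))

    encode-decode : ∀ k (q : IsCode k) → encode (decode k , q) ≡ k
    encode-decode k q = ≡.trans
      (encodeFin-cong (λ i j → fromℕ<-toℕ (decodeFin k i j) (bound (decode k , q) i j)))
      (encode-decodeFin k)

    encode-isCode : ∀ D → IsCode (encode D)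
    encode-isCode D@(_ , rows , cols) =
      (λ i → ≡.trans (sum-cong-≗ (λ j → decode-encode D i j)) (rows i)) ,
      (λ j → ≡.trans (sum-cong-≗ (λ i → decode-encode D i j)) (cols j))

    codes↔tables : Inverse (On.setoid {B = Σ (Fin codes) IsCode} (≡.setoid (Fin codes)) proj₁)
                           (tableSetoid r c)
    codes↔tables = record
      { to        = λ (k , q) → decode k , q
      ; from      = λ D → encode D , encode-isCode D
      ; to-cong   = λ { refl i j → refl }
      ; from-cong = λ {D} {E} → encode-cong D E
      ; inverse   = (λ { {D} refl → decode-encode D })
                  , (λ {(k , q)} {D} p → ≡.trans (encode-cong D (decode k , q) p) (encode-decode k q))
      }

contingencyTables : (r : Fin m → ℕ) (c : Fin n → ℕ) → Finite (tableSetoid r c)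
contingencyTables r c = record
  { card        = Finite.card tables
  ; enumeration = Composition.inverse (Finite.enumeration tables) codes↔tables
  }
  where
  open Enumerate r c
  tables = filterFin codes isCode?

module _ {c ℓ₁ ℓ₂ ℓ₃} (F : OrderedField c ℓ₁ ℓ₂ ℓ₃) where
  open OrderedField F

  sumOver : {S : Setoid a ℓ} → Finite S → (Setoid.Carrier S → Carrier) → Carrier
  sumOver S f = sum (λ k → f (Finite.element S k))

  per : (Fin N → Fin N → Carrier) → Carrier
  per {N = N} A = sumOver (permutations N) (λ σ → product (λ i → A i (σ ⟨$⟩ʳ i)))

  -- x ^ 0 reduces to 1# for every x, in particular for 0#.
  weight : (Fin m → Fin n → Carrier) → (Fin m → Fin n → ℕ) → Carrier
  weight w D = product (λ i → product (λ j → ((w i j ^ D i j) /ℕ (D i j !)) {{D i j ℕ.!≢0}}))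

  totalWeight : (Fin m → ℕ) → (Fin n → ℕ) → (Fin m → Fin n → Carrier) → Carrier
  totalWeight r c w = sumOver (contingencyTables r c) (λ D → weight w (proj₁ D))

{-# OPTIONS --safe #-}

-- Expand the permanent along its first row, whose class is i, and induct on N.
-- Deleting that row together with a column of class j leaves the block matrix
-- with margins r - e_i and c - e_j.  Writing T(r, c) for the total weight, the
-- divided powers w^d/d! satisfy d · w^d/d! = w · w^(d-1)/(d-1)!, so
--   r_i T(r, c) = ∑_D ∑_j d_ij weight(D) = ∑_j w_ij T(r - e_i, c - e_j),
-- where j runs over the classes with c_j > 0.  Multiplied by r! c!/r_i this is
-- the Laplace expansion, since each class j contributes c_j equal minors.

module Submission where

open import Defs
open import Algebra.Bundles using (CommutativeMonoid; CommutativeRing)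
import Algebra.Properties.CommutativeMonoid.Mult as CommutativeMonoidMult
import Algebra.Properties.CommutativeMonoid.Sum as CommutativeMonoidSum
import Algebra.Properties.CommutativeSemigroup as CommutativeSemigroupProperties
import Algebra.Properties.Semiring.Mult as SemiringMult
import Algebra.Properties.Semiring.Sum as SemiringSum
open import Data.Fin.Base using (Fin; zero; suc; punchIn; combine; remQuot; _↑ˡ_; _↑ʳ_)
open import Data.Fin.Permutation using (_⟨$⟩ʳ_; insert)
open import Data.Fin.Properties using (_≟_; suc-injective; remQuot-combine)
open import Data.Fin.Subset using (Subset; _∈_; _∉_; ∣_∣; inside; outside)
open import Data.Fin.Subset.Properties using (x∈p∩q⁺)
open import Data.Nat.Base as ℕ using (ℕ; zero; suc; NonZero; _!; _∸_)
import Data.Nat.Properties as ℕ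
open import Data.Product.Base using (∃; _×_; _,_; proj₁; proj₂)
open import Data.Sum.Base using (_⊎_; inj₁; inj₂)
open import Data.Vec.Base using ([]; _∷_; here; there)
open import Function.Base using (_∘_)
open import Function.Bundles using (module Inverse)
open import Relation.Binary.Bundles using (Setoid)
open import Relation.Binary.PropositionalEquality as ≡ using (_≡_; _≢_; _≗_; refl)
import Relation.Binary.Reasoning.Setoid as SetoidReasoning
open import Relation.Nullary using (yes; no; contradiction)

private
  variable
    m n N : ℕ

module ℕ* = CommutativeSemigroupProperties ℕ.*-commutativeSemigroup
module ℕΣ = SemiringSum ℕ.+-*-semiring

-- Kronecker delta and fibre sizes

δ : Fin n → Fin n → ℕ
δ zero    zero    = 1
δ zero    (suc j) = 0
δ (suc i) zero    = 0
δ (suc i) (suc j) = δ i j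

δ-refl : (i : Fin n) → δ i i ≡ 1
δ-refl zero    = refl
δ-refl (suc i) = δ-refl i

δ-≢ : {i j : Fin n} → i ≢ j → δ i j ≡ 0
δ-≢ {i = zero}  {zero}  i≢j = contradiction refl i≢j
δ-≢ {i = zero}  {suc j} i≢j = refl
δ-≢ {i = suc i} {zero}  i≢j = refl
δ-≢ {i = suc i} {suc j} i≢j = δ-≢ (i≢j ∘ ≡.cong suc)

sumℕ-δ : (i : Fin n) → sumℕ (δ i) ≡ 1
sumℕ-δ {suc n} zero    = ≡.cong suc (ℕΣ.sum-replicate-zero n)
sumℕ-δ         (suc i) = sumℕ-δ i

-- The arguments are exchanged on the right because `count` sums over the first argument of `δ`,
-- while `sumℕ-δ` sums over the second.
δ-injective-swap : (e : Fin m → Fin n) → (∀ {i j} → e i ≡ e j → i ≡ j) →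
                   ∀ i j → δ (e i) (e j) ≡ δ j i
δ-injective-swap e inj i j with j ≟ i
... | yes refl = ≡.trans (δ-refl (e i)) (≡.sym (δ-refl i))
... | no  j≢i  = ≡.trans (δ-≢ (j≢i ∘ ≡.sym ∘ inj)) (≡.sym (δ-≢ j≢i))

δ≤ : (f : Fin n → ℕ) {i : Fin n} → f i ≢ 0 → ∀ k → δ i k ℕ.≤ f k
δ≤ f {i} fi≢0 k with i ≟ k
... | yes refl = ℕ.≤-trans (ℕ.≤-reflexive (δ-refl i)) (ℕ.n≢0⇒n>0 fi≢0)
... | no  i≢k  = ℕ.≤-trans (ℕ.≤-reflexive (δ-≢ i≢k)) ℕ.z≤n

count : (Fin N → Fin m) → Fin m → ℕ
count f i = sumℕ (λ p → δ (f p) i)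

sumℕ≡0 : (f : Fin n → ℕ) → sumℕ f ≡ 0 → ∀ i → f i ≡ 0
sumℕ≡0 f e zero    = ℕ.m+n≡0⇒m≡0 (f zero) e
sumℕ≡0 f e (suc i) = sumℕ≡0 (f ∘ suc) (ℕ.m+n≡0⇒n≡0 (f zero) e) i

-- Finite sums in a commutative monoid, used for both sums and products

module SumProperties {c ℓ} (M : CommutativeMonoid c ℓ) where
  open CommutativeMonoid M renaming (refl to ≈-refl)
  open CommutativeMonoidSum M public
  open CommutativeMonoidMult M renaming (_×_ to _·_)
  open CommutativeSemigroupProperties commutativeSemigroup using (x∙yz≈y∙xz)
  open SetoidReasoning setoid

  ×-zeroʳ : ∀ k → k · ε ≈ ε
  ×-zeroʳ zero    = ≈-refl
  ×-zeroʳ (suc k) = trans (identityˡ _) (×-zeroʳ k)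

  sum-zero : (f : Fin n → Carrier) → (∀ k → f k ≈ ε) → sum f ≈ ε
  sum-zero {n} f f≈ε = trans (sum-cong-≋ f≈ε) (sum-replicate-zero n)

  -- Since `δ` takes values in ℕ, it acts as a multiplicity in any commutative monoid.
  sum-single : ∀ (i : Fin n) (f : Fin n → Carrier) → sum (λ k → δ i k · f k) ≈ f i
  sum-single {suc n} zero f = trans
    (∙-cong (identityʳ _) (sum-replicate-zero n)) (identityʳ _)
  sum-single (suc i) f = trans (identityˡ _) (sum-single i (f ∘ suc))

  -- The extra terms `x` and `y` are carried to position `i` by commutativity. Nothing is cancelled,
  -- so in multiplicative form it compares products differing in one factor without division.
  sum-replace : ∀ (i : Fin n) (f g : Fin n → Carrier) {x y} → x ∙ f i ≈ y ∙ g i →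
                (∀ k → i ≢ k → f k ≈ g k) → x ∙ sum f ≈ y ∙ sum g
  sum-replace zero f g {x} {y} e f≈g = begin
    x ∙ (f zero ∙ sum (f ∘ suc))   ≈⟨ assoc x _ _ ⟨
    (x ∙ f zero) ∙ sum (f ∘ suc)   ≈⟨ ∙-cong e (sum-cong-≋ (λ k → f≈g (suc k) λ ())) ⟩
    (y ∙ g zero) ∙ sum (g ∘ suc)   ≈⟨ assoc y _ _ ⟩
    y ∙ (g zero ∙ sum (g ∘ suc))   ∎
  sum-replace (suc i) f g {x} {y} e f≈g = begin
    x ∙ (f zero ∙ sum (f ∘ suc))   ≈⟨ x∙yz≈y∙xz x _ _ ⟩
    f zero ∙ (x ∙ sum (f ∘ suc))   ≈⟨ ∙-cong (f≈g zero λ ())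
                                       (sum-replace i (f ∘ suc) (g ∘ suc) e
                                         (λ k i≢k → f≈g (suc k) (i≢k ∘ suc-injective))) ⟩
    g zero ∙ (y ∙ sum (g ∘ suc))   ≈⟨ x∙yz≈y∙xz _ y _ ⟩
    y ∙ (g zero ∙ sum (g ∘ suc))   ∎

  sumℕ-· : ∀ (d : Fin n → ℕ) x → sumℕ d · x ≈ sum (λ k → d k · x)
  sumℕ-· {zero}  d x = ≈-refl
  sumℕ-· {suc n} d x = trans (×-homo-+ x (d zero) (sumℕ (d ∘ suc))) (∙-congˡ (sumℕ-· (d ∘ suc) x))

  ·-distrib-sum : ∀ k (f : Fin n → Carrier) → k · sum f ≈ sum (λ i → k · f i)
  ·-distrib-sum {zero}  k f = ×-zeroʳ k
  ·-distrib-sum {suc n} k f = trans (×-distrib-+ (f zero) _ k) (∙-congˡ (·-distrib-sum k (f ∘ suc)))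

  -- Double counting: expand each `f (g q)` as a delta sum over `j`, then exchange the sums.
  sum-fibres : ∀ (g : Fin N → Fin n) (f : Fin n → Carrier) →
               sum (f ∘ g) ≈ sum (λ j → count g j · f j)
  sum-fibres g f = begin
    sum (f ∘ g)                                ≈⟨ sum-cong-≋ (λ q → sum-single (g q) f) ⟨
    sum (λ q → sum (λ j → δ (g q) j · f j))    ≈⟨ ∑-comm (λ q j → δ (g q) j · f j) ⟩
    sum (λ j → sum (λ q → δ (g q) j · f j))    ≈⟨ sum-cong-≋ (λ j → sumℕ-· (λ q → δ (g q) j) (f j)) ⟨
    sum (λ j → count g j · f j)                ∎

  -- By `sum-fibres` it suffices that `f k` equals `count e k` copies of itself. On the image the
  -- count is 1 by injectivity; where `f k` is `ε`, any number of copies is `ε`.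
  sum-injection : ∀ (f : Fin n → Carrier) (e : Fin m → Fin n) →
                  (∀ {i j} → e i ≡ e j → i ≡ j) →
                  (∀ k → (∃ λ i → e i ≡ k) ⊎ f k ≈ ε) →
                  sum f ≈ sum (f ∘ e)
  sum-injection f e inj support = begin
    sum f                                      ≈⟨ sum-cong-≋ (λ k → fibre k (support k)) ⟩
    sum (λ k → count e k · f k)                ≈⟨ sum-fibres e f ⟨
    sum (f ∘ e)                                ∎
    where
    count-image : ∀ i → count e (e i) ≡ 1
    count-image i = ≡.trans (ℕΣ.sum-cong-≗ (λ j → δ-injective-swap e inj j i)) (sumℕ-δ i)

    fibre : ∀ k → (∃ λ i → e i ≡ k) ⊎ f k ≈ ε → f k ≈ count e k · f k
    fibre _ (inj₁ (i , refl)) = trans (sym (×-homo-1 _)) (×-congˡ (≡.sym (count-image i)))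
    fibre k (inj₂ fk≈ε)       = begin
      f k              ≈⟨ fk≈ε ⟩
      ε                ≈⟨ ×-zeroʳ (count e k) ⟨
      count e k · ε    ≈⟨ ×-congʳ (count e k) fk≈ε ⟨
      count e k · f k  ∎

  sum-↑ : ∀ a {b} (f : Fin (a ℕ.+ b) → Carrier) →
          sum f ≈ sum (λ i → f (i ↑ˡ b)) ∙ sum (λ j → f (a ↑ʳ j))
  sum-↑ zero    f = sym (identityˡ _)
  sum-↑ (suc a) f = trans (∙-congˡ (sum-↑ a (f ∘ suc))) (sym (assoc _ _ _))

  sum-combine : ∀ a {b} (f : Fin (a ℕ.* b) → Carrier) →
                sum f ≈ sum (λ i → sum (λ j → f (combine {a} {b} i j)))
  sum-combine zero        f = ≈-refl
  sum-combine (suc a) {b} f = trans (sum-↑ b f) (∙-congˡ (sum-combine a (λ k → f (b ↑ʳ k))))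

-- Products of factorials and margins under a unit change

module ℕΠ = SumProperties ℕ.*-1-commutativeMonoid

factorials-cong : {r r′ : Fin m → ℕ} → r ≗ r′ → factorials r ≡ factorials r′
factorials-cong r≗r′ = ℕΠ.sum-cong-≗ (λ i → ≡.cong _! (r≗r′ i))

factorials-zero : {r : Fin m → ℕ} → (∀ i → r i ≡ 0) → factorials r ≡ 1
factorials-zero r≡0 = ℕΠ.sum-zero _ (λ i → ≡.cong _! (r≡0 i))

factorials-increment : ∀ i (r : Fin m → ℕ) →
                       factorials (λ k → δ i k ℕ.+ r k) ≡ suc (r i) ℕ.* factorials r
factorials-increment i r = ≡.trans (≡.sym (ℕ.*-identityˡ _))
  (ℕΠ.sum-replace i (λ k → (δ i k ℕ.+ r k) !) (λ k → r k !)
    {x = 1} {y = suc (r i)}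
    (≡.trans (ℕ.*-identityˡ _) (≡.cong (λ d → (d ℕ.+ r i) !) (δ-refl i)))
    (λ k i≢k → ≡.cong (λ d → (d ℕ.+ r k) !) (δ-≢ i≢k)))

-- Gives the column margins of a minor: deleting `q` costs its own class one member.
count-punchIn : ∀ (g : Fin (suc N) → Fin n) q j →
                count g j ≡ δ (g q) j ℕ.+ count (g ∘ punchIn q) j
count-punchIn g q j = ℕΣ.sum-remove {i = q} (λ p → δ (g p) j)

-- Raising and lowering one entry of a table

unit : Fin m → Fin n → Fin m → Fin n → ℕ
unit i j k l = δ i k ℕ.* δ j l

unit-refl : ∀ (i : Fin m) (j : Fin n) → unit i j i j ≡ 1
unit-refl i j = ≡.cong₂ ℕ._*_ (δ-refl i) (δ-refl j)

unit-≢ˡ : ∀ {i k : Fin m} (j l : Fin n) → i ≢ k → unit i j k l ≡ 0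
unit-≢ˡ j l i≢k = ≡.cong (ℕ._* δ j l) (δ-≢ i≢k)

unit-≢ʳ : ∀ (i k : Fin m) {j l : Fin n} → j ≢ l → unit i j k l ≡ 0
unit-≢ʳ i k j≢l = ≡.trans (≡.cong (δ i k ℕ.*_) (δ-≢ j≢l)) (ℕ.*-zeroʳ (δ i k))

unit≤ : ∀ (D : Fin m → Fin n → ℕ) {i j} → D i j ≢ 0 → ∀ k l → unit i j k l ℕ.≤ D k l
unit≤ D {i} {j} Dij≢0 k l with i ≟ k | j ≟ l
... | no i≢k   | _        = ℕ.≤-trans (ℕ.≤-reflexive (unit-≢ˡ j l i≢k)) ℕ.z≤n
... | yes _    | no j≢l   = ℕ.≤-trans (ℕ.≤-reflexive (unit-≢ʳ i k j≢l)) ℕ.z≤n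
... | yes refl | yes refl = ℕ.≤-trans (ℕ.≤-reflexive (unit-refl i j)) (ℕ.n≢0⇒n>0 Dij≢0)

increment : Fin m → Fin n → (Fin m → Fin n → ℕ) → Fin m → Fin n → ℕ
increment i j D k l = unit i j k l ℕ.+ D k l

increment-row : ∀ (i : Fin m) (j : Fin n) D k →
                sumℕ (increment i j D k) ≡ δ i k ℕ.+ sumℕ (D k)
increment-row i j D k = begin
  sumℕ (increment i j D k)              ≡⟨ ℕΣ.∑-distrib-+ (unit i j k) (D k) ⟩
  sumℕ (unit i j k) ℕ.+ sumℕ (D k)      ≡⟨ ≡.cong (ℕ._+ sumℕ (D k)) (ℕΣ.*-distribˡ-sum (δ i k) (δ j)) ⟨
  δ i k ℕ.* sumℕ (δ j) ℕ.+ sumℕ (D k)   ≡⟨ ≡.cong (λ s → δ i k ℕ.* s ℕ.+ sumℕ (D k)) (sumℕ-δ j) ⟩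
  δ i k ℕ.* 1 ℕ.+ sumℕ (D k)            ≡⟨ ≡.cong (ℕ._+ sumℕ (D k)) (ℕ.*-identityʳ (δ i k)) ⟩
  δ i k ℕ.+ sumℕ (D k)                  ∎
  where
  open ≡.≡-Reasoning

increment-column : ∀ (i : Fin m) (j : Fin n) D l →
                   sumℕ (λ k → increment i j D k l) ≡ δ j l ℕ.+ sumℕ (λ k → D k l)
increment-column i j D l = begin
  sumℕ (λ k → increment i j D k l)      ≡⟨ ℕΣ.∑-distrib-+ (λ k → unit i j k l) (λ k → D k l) ⟩
  sumℕ (λ k → unit i j k l) ℕ.+ s       ≡⟨ ≡.cong (ℕ._+ s) (ℕΣ.*-distribʳ-sum (δ j l) (δ i)) ⟨
  sumℕ (δ i) ℕ.* δ j l ℕ.+ s            ≡⟨ ≡.cong (λ t → t ℕ.* δ j l ℕ.+ s) (sumℕ-δ i) ⟩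
  1 ℕ.* δ j l ℕ.+ s                     ≡⟨ ≡.cong (ℕ._+ s) (ℕ.*-identityˡ (δ j l)) ⟩
  δ j l ℕ.+ s                           ∎
  where
  open ≡.≡-Reasoning
  s = sumℕ (λ k → D k l)

incrementTable : ∀ i j {r : Fin m → ℕ} {c : Fin n → ℕ} → ContingencyTable r c →
                 ContingencyTable (λ k → δ i k ℕ.+ r k) (λ l → δ j l ℕ.+ c l)
incrementTable i j (D , rows , columns) = increment i j D ,
  (λ k → ≡.trans (increment-row i j D k) (≡.cong (δ i k ℕ.+_) (rows k))) ,
  (λ l → ≡.trans (increment-column i j D l) (≡.cong (δ j l ℕ.+_) (columns l)))

-- A nonzero entry at `(i , j)` makes the truncated subtraction of `unit` exact everywhere, and the
-- margins follow by cancelling the delta in `increment-row` and `increment-column`.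
decrementTable : ∀ i j {r : Fin m → ℕ} {c : Fin n → ℕ}
                 ((D , _) : ContingencyTable (λ k → δ i k ℕ.+ r k) (λ l → δ j l ℕ.+ c l)) →
                 D i j ≢ 0 →
                 ∃ λ ((E , _) : ContingencyTable r c) → ∀ k l → increment i j E k l ≡ D k l
decrementTable i j {r} {c} (D , rows , columns) Dij≢0 = (E , rowsE , columnsE) , E+1≡D
  where
  E = λ k l → D k l ∸ unit i j k l

  E+1≡D : ∀ k l → increment i j E k l ≡ D k l
  E+1≡D k l = ℕ.m+[n∸m]≡n (unit≤ D Dij≢0 k l)

  rowsE : ∀ k → sumℕ (E k) ≡ r k
  rowsE k = ℕ.+-cancelˡ-≡ (δ i k) _ _
    (≡.trans (≡.sym (increment-row i j E k)) (≡.trans (ℕΣ.sum-cong-≗ (E+1≡D k)) (rows k)))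

  columnsE : ∀ l → sumℕ (λ k → E k l) ≡ c l
  columnsE l = ℕ.+-cancelˡ-≡ (δ j l) _ _
    (≡.trans (≡.sym (increment-column i j E l)) (≡.trans (ℕΣ.sum-cong-≗ (λ k → E+1≡D k l)) (columns l)))

-- From partitions to class functions

subset-size : ∀ (S : Subset N) (h : Fin N → ℕ) →
              (∀ p → p ∈ S → h p ≡ 1) → (∀ p → p ∉ S → h p ≡ 0) → sumℕ h ≡ ∣ S ∣
subset-size []            h h≡1 h≡0 = refl
subset-size (inside ∷ S)  h h≡1 h≡0 = ≡.cong₂ ℕ._+_ (h≡1 zero here)
  (subset-size S (h ∘ suc) (λ p → h≡1 (suc p) ∘ there) (λ p p∉S → h≡0 (suc p) λ { (there p∈S) → p∉S p∈S }))
subset-size (outside ∷ S) h h≡1 h≡0 = ≡.cong₂ ℕ._+_ (h≡0 zero λ ())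
  (subset-size S (h ∘ suc) (λ p → h≡1 (suc p) ∘ there) (λ p p∉S → h≡0 (suc p) λ { (there p∈S) → p∉S p∈S }))

module _ {P : Fin m → Subset N} (P-union : IsDisjointUnion P) where
  open IsDisjointUnion P-union

  part : Fin N → Fin m
  part p = proj₁ (covers p)

  ∈-part : ∀ p → p ∈ P (part p)
  ∈-part p = proj₂ (covers p)

  part-unique : ∀ {i p} → p ∈ P i → part p ≡ i
  part-unique {i} {p} p∈Pi with part p ≟ i
  ... | yes e = e
  ... | no  d = contradiction (p , x∈p∩q⁺ (∈-part p , p∈Pi)) (disjoint d)

  -- By disjointness, `δ (part p) i` is the indicator of `P i` as a function of `p`.
  count-part : ∀ i → count part i ≡ ∣ P i ∣
  count-part i = subset-size (P i) _
    (λ p p∈Pi → ≡.trans (≡.cong (λ k → δ k i) (part-unique p∈Pi)) (δ-refl i))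
    (λ p p∉Pi → δ-≢ {i = part p} λ { refl → p∉Pi (∈-part p) })

-- Reciprocals of natural numbers and divided powers

module _ {a ℓ₁ ℓ₂ ℓ₃} (F : OrderedField a ℓ₁ ℓ₂ ℓ₃) where
  open OrderedField F
    using (Carrier; _≈_; _+_; _*_; 0#; 1#; sum; product; _^_; _·_; fromℕ; recip; fromℕ*recip≈1; _/ℕ_;
           setoid; commutativeRing; semiring; +-identityʳ; *-congˡ; *-congʳ; *-comm; *-assoc;
           *-identityˡ; *-identityʳ)
  open Setoid setoid using () renaming (sym to ≈-sym; trans to ≈-trans; reflexive to ≈-reflexive)
  open CommutativeRing commutativeRing using (+-commutativeMonoid; *-commutativeMonoid; *-commutativeSemigroup)
  open CommutativeSemigroupProperties *-commutativeSemigroup using (x∙yz≈y∙xz)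
  open SemiringSum semiring using (*-distribˡ-sum)
  open SemiringMult semiring
    using (×-congʳ; ×-congˡ; ×-cong; ×-homo-1; ×-assocˡ; ×-comm-*; ×-assoc-*)
  open SumProperties +-commutativeMonoid hiding (sum)
  module Product = SumProperties *-commutativeMonoid
  open SetoidReasoning setoid

  fromℕ* : ∀ k x → fromℕ k * x ≈ k · x
  fromℕ* k x = ≈-trans (×-assoc-* k 1# x) (×-congʳ k (*-identityˡ x))

  -- Uniqueness of inverses. It stands in for a product rule for `recip`, which is only known
  -- through the equation it solves.
  recip-unique : ∀ k .{{_ : NonZero k}} {y} → k · y ≈ 1# → recip k ≈ y
  recip-unique k {y} e = begin
    recip k                  ≈⟨ *-identityʳ _ ⟨
    recip k * 1#             ≈⟨ *-congˡ e ⟨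
    recip k * (k · y)        ≈⟨ *-congˡ (fromℕ* k y) ⟨
    recip k * (fromℕ k * y)  ≈⟨ *-assoc _ _ _ ⟨
    recip k * fromℕ k * y    ≈⟨ *-congʳ (≈-trans (*-comm _ _) (fromℕ*recip≈1 k)) ⟩
    1# * y                   ≈⟨ *-identityˡ y ⟩
    y                        ∎

  /ℕ-unique : ∀ k .{{_ : NonZero k}} {x y} → k · x ≈ y → x ≈ y /ℕ k
  /ℕ-unique k {x} {y} e = begin
    x                        ≈⟨ *-identityʳ x ⟨
    x * 1#                   ≈⟨ *-congˡ (fromℕ*recip≈1 k) ⟨
    x * (fromℕ k * recip k)  ≈⟨ *-assoc _ _ _ ⟨
    x * fromℕ k * recip k    ≈⟨ *-congʳ (≈-trans (*-comm _ _) (≈-trans (fromℕ* k x) e)) ⟩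
    y * recip k              ∎

  -- The divided power of `x`; it unfolds to the factor of a single entry in `weight`.
  entryWeight : Carrier → ℕ → Carrier
  entryWeight x d = ((x ^ d) /ℕ (d !)) {{d ℕ.!≢0}}

  entryWeight-zero : ∀ x → entryWeight x 0 ≈ 1#
  entryWeight-zero x = ≈-trans (*-identityˡ _) (recip-unique 1 (×-homo-1 1#))

  -- The inverse of `suc d !`, taken `suc d` times, is an inverse of `d !`, hence equals its
  -- `recip`.
  entryWeight-suc : ∀ x d → fromℕ (suc d) * entryWeight x (suc d) ≈ x * entryWeight x d
  entryWeight-suc x d = begin
    fromℕ (suc d) * (x * x ^ d * z)    ≈⟨ x∙yz≈y∙xz _ _ _ ⟩
    x * x ^ d * (fromℕ (suc d) * z)    ≈⟨ *-congˡ (fromℕ* (suc d) z) ⟩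
    x * x ^ d * (suc d · z)            ≈⟨ *-congˡ (recip-unique (d !) {{d ℕ.!≢0}} d!*[1+d]z≈1) ⟨
    x * x ^ d * recip (d !) {{d ℕ.!≢0}}   ≈⟨ *-assoc _ _ _ ⟩
    x * entryWeight x d                ∎
    where
    z = recip (suc d !) {{suc d ℕ.!≢0}}
    d!*[1+d]z≈1 : (d !) · (suc d · z) ≈ 1#
    d!*[1+d]z≈1 = begin
      (d !) · (suc d · z)    ≈⟨ ×-assocˡ z (d !) (suc d) ⟩
      (d ! ℕ.* suc d) · z    ≈⟨ ×-congˡ (ℕ.*-comm (d !) (suc d)) ⟩
      (suc d !) · z          ≈⟨ fromℕ* (suc d !) z ⟨
      fromℕ (suc d !) * z    ≈⟨ fromℕ*recip≈1 (suc d !) {{suc d ℕ.!≢0}} ⟩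
      1#                     ∎

  -- Reindexing sums over finite setoids

  sumOver-injection : ∀ {a₁ a₂ e₁ e₂} {S : Setoid a₁ e₁} {T : Setoid a₂ e₂} (FS : Finite S) (FT : Finite T) →
                      (f : Setoid.Carrier T → Carrier) → (∀ {s t} → Setoid._≈_ T s t → f s ≈ f t) →
                      (e : Setoid.Carrier S → Setoid.Carrier T) →
                      (∀ {s t} → Setoid._≈_ S s t → Setoid._≈_ T (e s) (e t)) →
                      (∀ {s t} → Setoid._≈_ T (e s) (e t) → Setoid._≈_ S s t) →
                      (∀ t → (∃ λ s → Setoid._≈_ T (e s) t) ⊎ f t ≈ 0#) →
                      sumOver F FT f ≈ sumOver F FS (f ∘ e)
  sumOver-injection {S = S} {T} FS FT f f-cong e e-cong e-inj support = begin
    sumOver F FT f                   ≈⟨ sum-injection (f ∘ T.to) e′ e′-inj support′ ⟩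
    sum (λ k → f (T.to (e′ k)))      ≈⟨ sum-cong-≋ {Finite.card FS} (λ k → f-cong (T.inverseˡ {e (S.to k)} refl)) ⟩
    sumOver F FS (f ∘ e)             ∎
    where
    module S = Inverse (Finite.enumeration FS)
    module T = Inverse (Finite.enumeration FT)
    module S≈ = Setoid S
    module T≈ = Setoid T

    -- The map `e` is transported to indices, where the setoid relations become propositional
    -- equality and `sum-injection` applies.
    e′ : Fin (Finite.card FS) → Fin (Finite.card FT)
    e′ k = T.from (e (S.to k))

    e′-inj : ∀ {i j} → e′ i ≡ e′ j → i ≡ j
    e′-inj {i} {j} p = ≡.trans (≡.sym (S.inverseʳ (S≈.sym ij))) (S.inverseʳ S≈.refl)
      where
      ij : S.to i S≈.≈ S.to j
      ij = e-inj (T≈.trans (T≈.sym (T.inverseˡ refl)) (T≈.trans (T.to-cong p) (T.inverseˡ refl)))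

    support′ : ∀ k → (∃ λ i → e′ i ≡ k) ⊎ f (T.to k) ≈ 0#
    support′ k with support (T.to k)
    ... | inj₂ z       = inj₂ z
    ... | inj₁ (s , p) = inj₁ (S.from s , T.inverseʳ (T≈.trans (e-cong (S.inverseˡ refl)) p))

  -- Pointwise equal margins still give distinct table types and enumerations; the identity on the
  -- underlying matrices matches them.
  sumOver-tables-cong : {r r′ : Fin m → ℕ} {c c′ : Fin n → ℕ} → r ≗ r′ → c ≗ c′ →
                        (f : (Fin m → Fin n → ℕ) → Carrier) →
                        (∀ {D E} → (∀ i j → D i j ≡ E i j) → f D ≈ f E) →
                        sumOver F (contingencyTables r c) (f ∘ proj₁) ≈
                        sumOver F (contingencyTables r′ c′) (f ∘ proj₁)
  sumOver-tables-cong {r = r} {r′} {c} {c′} r≗r′ c≗c′ f f-cong =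
    sumOver-injection (contingencyTables r′ c′) (contingencyTables r c) (f ∘ proj₁) f-cong
      (λ (D , rows , columns) → D , (λ i → ≡.trans (rows i) (≡.sym (r≗r′ i)))
                                  , (λ j → ≡.trans (columns j) (≡.sym (c≗c′ j))))
      (λ p → p) (λ p → p)
      (λ (D , rows , columns) → inj₁ ((D , (λ i → ≡.trans (rows i) (r≗r′ i))
                                         , (λ j → ≡.trans (columns j) (c≗c′ j))) , λ _ _ → refl))

  -- Weights of tables and their moments

  module _ (w : Fin m → Fin n → Carrier) where

    weight-cong : ∀ {D E} → (∀ i j → D i j ≡ E i j) → weight F w D ≈ weight F w E
    weight-cong D≡E = Product.sum-cong-≋ (λ i → Product.sum-cong-≋ (λ j →
      ≈-reflexive (≡.cong (entryWeight (w i j)) (D≡E i j))))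

    -- Only the factor at `(i , j)` changes. Replacement among the rows, then among the entries of
    -- row `i`, brings both coefficients to it, where `entryWeight-suc` applies.
    weight-increment : ∀ i j D → fromℕ (suc (D i j)) * weight F w (increment i j D) ≈ w i j * weight F w D
    weight-increment i j D = Product.sum-replace i _ _
      (Product.sum-replace j _ _
        (≈-trans (*-congˡ (entry (≡.cong (ℕ._+ D i j) (unit-refl i j)))) (entryWeight-suc (w i j) (D i j)))
        (λ l j≢l → entry (≡.cong (ℕ._+ D i l) (unit-≢ʳ i i j≢l))))
      (λ k i≢k → Product.sum-cong-≋ (λ l → entry (≡.cong (ℕ._+ D k l) (unit-≢ˡ j l i≢k))))
      where
      entry : ∀ {x d e} → d ≡ e → entryWeight x d ≈ entryWeight x e
      entry {x} d≡e = ≈-reflexive (≡.cong (entryWeight x) d≡e)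

    totalWeight-cong : ∀ {r r′ c c′} → r ≗ r′ → c ≗ c′ → totalWeight F r c w ≈ totalWeight F r′ c′ w
    totalWeight-cong r≗r′ c≗c′ = sumOver-tables-cong r≗r′ c≗c′ (weight F w) weight-cong

    totalWeight-zero : ∀ {r c} → (∀ i → r i ≡ 0) → (∀ j → c j ≡ 0) → totalWeight F r c w ≈ 1#
    totalWeight-zero {r} {c} r≡0 c≡0 = begin
      totalWeight F r c w
        -- The zero table is the only one, so its index alone exhausts the enumeration.
        ≈⟨ sum-injection {m = 1} (λ k → weight F w (proj₁ (T.to k))) (λ _ → T.from 0T)
             (λ { {zero} {zero} _ → refl }) (λ k → inj₁ (zero , T.inverseʳ (λ i j → ≡.sym (D≡0 (T.to k) i j)))) ⟩
      weight F w (proj₁ (T.to (T.from 0T))) + 0#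
        ≈⟨ +-identityʳ _ ⟩
      weight F w (proj₁ (T.to (T.from 0T)))
        ≈⟨ weight-cong (D≡0 (T.to (T.from 0T))) ⟩
      weight F w (λ _ _ → 0)
        ≈⟨ Product.sum-zero _ (λ i → Product.sum-zero _ (λ j → entryWeight-zero (w i j))) ⟩
      1# ∎
      where
      module T = Inverse (Finite.enumeration (contingencyTables r c))

      0T : ContingencyTable r c
      0T = (λ _ _ → 0) , (λ i → ≡.trans (ℕΣ.sum-replicate-zero n) (≡.sym (r≡0 i)))
                       , (λ j → ≡.trans (ℕΣ.sum-replicate-zero m) (≡.sym (c≡0 j)))

      D≡0 : ((D , _) : ContingencyTable r c) → ∀ i j → D i j ≡ 0
      D≡0 (D , rows , _) i = sumℕ≡0 (D i) (≡.trans (rows i) (r≡0 i))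

    -- The Euler operator w i j * ∂/∂(w i j) applied to the total weight.
    moment : (Fin m → ℕ) → (Fin n → ℕ) → Fin m → Fin n → Carrier
    moment r c i j = sumOver F (contingencyTables r c) (λ (D , _) → D i j · weight F w D)

    moment-summand-cong : ∀ i j {D E : Fin m → Fin n → ℕ} → (∀ i j → D i j ≡ E i j) →
                          D i j · weight F w D ≈ E i j · weight F w E
    moment-summand-cong i j D≡E = ×-cong (D≡E i j) (weight-cong D≡E)

    moment-cong : ∀ {r r′ c c′} → r ≗ r′ → c ≗ c′ → ∀ i j → moment r c i j ≈ moment r′ c′ i j
    moment-cong r≗r′ c≗c′ i j = sumOver-tables-cong r≗r′ c≗c′ (λ D → D i j · weight F w D) (moment-summand-cong i j)

    moment-zero : ∀ {r c} i j → c j ≡ 0 → moment r c i j ≈ 0#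
    moment-zero {r} {c} i j cj≡0 = sum-zero _ (λ k → vanish (Finite.element (contingencyTables r c) k))
      where
      vanish : ((D , _) : ContingencyTable r c) → D i j · weight F w D ≈ 0#
      vanish (D , _ , columns) = ×-congˡ (sumℕ≡0 (λ k → D k j) (≡.trans (columns j) cj≡0) i)

    -- After the sums are exchanged, the multiplicities in each table add up to its row sum `r i`.
    sum-moment : ∀ r c i → sum (moment r c i) ≈ r i · totalWeight F r c w
    sum-moment r c i = begin
      sum (moment r c i)                       ≈⟨ ∑-comm (λ j k → table k i j · weight F w (table k)) ⟩
      sum (λ k → sum (λ j → table k i j · weight F w (table k)))
                                               ≈⟨ sum-cong-≋ (λ k → sumℕ-· (table k i) _) ⟨
      sum (λ k → sumℕ (table k i) · weight F w (table k))
                                               ≈⟨ sum-cong-≋ (λ k → ×-congˡ (proj₁ (proj₂ (Finite.element (contingencyTables r c) k)) i)) ⟩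
      sum (λ k → r i · weight F w (table k))   ≈⟨ ·-distrib-sum (r i) (λ k → weight F w (table k)) ⟨
      r i · totalWeight F r c w                ∎
      where
      table = λ k → proj₁ (Finite.element (contingencyTables r c) k)

    -- Tables with a zero entry at `(i , j)` contribute nothing; the others are increments of unique
    -- tables with margins `r` and `c`, to which `weight-increment` applies.
    moment-increment : ∀ r c i j → moment (λ k → δ i k ℕ.+ r k) (λ l → δ j l ℕ.+ c l) i j ≈
                                   w i j * totalWeight F r c w
    moment-increment r c i j = begin
      moment r⁺ c⁺ i j
        ≈⟨ sumOver-injection (contingencyTables r c) (contingencyTables r⁺ c⁺)
             (λ (D , _) → D i j · weight F w D) (moment-summand-cong i j)
             (incrementTable i j)
             (λ p k l → ≡.cong (unit i j k l ℕ.+_) (p k l))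
             (λ p k l → ℕ.+-cancelˡ-≡ (unit i j k l) _ _ (p k l))
             support ⟩
      sumOver F (contingencyTables r c) (λ (D , _) → increment i j D i j · weight F w (increment i j D))
        ≈⟨ sum-cong-≋ (λ k → summand (proj₁ (Finite.element (contingencyTables r c) k))) ⟩
      sumOver F (contingencyTables r c) (λ (D , _) → w i j * weight F w D)
        ≈⟨ *-distribˡ-sum (w i j) (λ k → weight F w (proj₁ (Finite.element (contingencyTables r c) k))) ⟨
      w i j * totalWeight F r c w ∎
      where
      r⁺ = λ k → δ i k ℕ.+ r k
      c⁺ = λ l → δ j l ℕ.+ c l

      summand : ∀ D → increment i j D i j · weight F w (increment i j D) ≈ w i j * weight F w D
      summand D = begin
        increment i j D i j · weight F w (increment i j D)       ≈⟨ ×-congˡ (≡.cong (ℕ._+ D i j) (unit-refl i j)) ⟩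
        suc (D i j) · weight F w (increment i j D)               ≈⟨ fromℕ* (suc (D i j)) _ ⟨
        fromℕ (suc (D i j)) * weight F w (increment i j D)       ≈⟨ weight-increment i j D ⟩
        w i j * weight F w D                                     ∎

      support : (t : ContingencyTable r⁺ c⁺) →
                (∃ λ s → ∀ k l → proj₁ (incrementTable i j s) k l ≡ proj₁ t k l) ⊎
                proj₁ t i j · weight F w (proj₁ t) ≈ 0#
      support t with proj₁ t i j ℕ.≟ 0
      ... | yes z = inj₂ (×-congˡ z)
      ... | no nz = inj₁ (decrementTable i j t nz)

  -- Expansion of the permanent along its first row

  per-cong : {A B : Fin N → Fin N → Carrier} → (∀ p q → A p q ≈ B p q) → per F A ≈ per F B
  per-cong {N = N} A≈B = sum-cong-≋ (λ k → Product.sum-cong-≋ (λ p →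
    A≈B p (Finite.element (permutations N) k ⟨$⟩ʳ p)))

  -- The enumeration codes a permutation as the image of `zero` together with a permutation of the
  -- remaining indices, so the sum over codes is already a double sum.
  per-expand : (A : Fin (suc N) → Fin (suc N) → Carrier) →
               per F A ≈ sum (λ q → A zero q * per F (λ p s → A (suc p) (punchIn q s)))
  per-expand {N = N} A = begin
    per F A
      ≈⟨ sum-combine (suc N) {N !} (λ k → term (remQuot {suc N} (N !) k)) ⟩
    sum (λ q → sum (λ s → term (remQuot {suc N} (N !) (combine {suc N} {N !} q s))))
      ≈⟨ sum-cong-≋ {suc N} (λ q → sum-cong-≋ {N !} (λ s → ≈-reflexive (≡.cong term (remQuot-combine {suc N} q s)))) ⟩
    sum (λ q → sum (λ s → term (q , s)))
      -- By computation, `insert zero q` sends `zero` to `q` and follows the smaller permutation by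
      -- `punchIn q`.
      ≈⟨ sum-cong-≋ (λ q → *-distribˡ-sum (A zero q) (λ s → product (λ p → A (suc p) (punchIn q (perm s ⟨$⟩ʳ p))))) ⟨
    sum (λ q → A zero q * per F (λ p s → A (suc p) (punchIn q s))) ∎
    where
    perm = Finite.element (permutations N)

    term : Fin (suc N) × Fin (N !) → Carrier
    term (q , s) = product (λ p → A p (insert zero q (perm s) ⟨$⟩ʳ p))

  -- Induction on the size of the matrix

  module _ (w : Fin m → Fin n → Carrier) where

    -- With class functions in place of partitions, passing to a minor is precomposition with `suc`
    -- and `punchIn q`. Empty classes are allowed, since deletions create them, and keeping the
    -- factorials on the left avoids division.
    factorials*totalWeight≈per : (f : Fin N → Fin m) (g : Fin N → Fin n) →
      (factorials (count f) ℕ.* factorials (count g)) · totalWeight F (count f) (count g) w ≈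
      per F (λ p q → w (f p) (g q))
    factorials*totalWeight≈per {N = zero} f g = begin
      (factorials (count f) ℕ.* factorials (count g)) · totalWeight F (count f) (count g) w
        ≈⟨ ×-cong (≡.cong₂ ℕ._*_ (factorials-zero {r = count f} (λ _ → refl)) (factorials-zero {r = count g} (λ _ → refl)))
                  (totalWeight-zero w (λ _ → refl) (λ _ → refl)) ⟩
      -- This and the permanent of the empty matrix both reduce to `1# + 0#`.
      1 · 1#  ∎
    factorials*totalWeight≈per {N = suc N} f g = ≈-sym (begin
      per F (λ p q → w (f p) (g q))
        ≈⟨ per-expand (λ p q → w (f p) (g q)) ⟩
      sum (λ q → w i (g q) * per F (λ p s → w (f (suc p)) (g (punchIn q s))))
        ≈⟨ sum-cong-≋ (λ q → *-congˡ {w i (g q)} (factorials*totalWeight≈per (f ∘ suc) (g ∘ punchIn q))) ⟨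
      sum (λ q → w i (g q) * ((factorials r′ ℕ.* factorials (count (g ∘ punchIn q))) ·
                              totalWeight F r′ (count (g ∘ punchIn q)) w))
        ≈⟨ sum-cong-≋ summand ⟩
      sum (λ q → (factorials r′ ℕ.* factorials (c⁻ (g q))) · moment w r c i (g q))
        ≈⟨ sum-fibres g (λ j → (factorials r′ ℕ.* factorials (c⁻ j)) · moment w r c i j) ⟩
      sum (λ j → c j · ((factorials r′ ℕ.* factorials (c⁻ j)) · moment w r c i j))
        ≈⟨ sum-cong-≋ absorb ⟩
      sum (λ j → (factorials r′ ℕ.* factorials c) · moment w r c i j)
        ≈⟨ ·-distrib-sum (factorials r′ ℕ.* factorials c) (moment w r c i) ⟨
      (factorials r′ ℕ.* factorials c) · sum (moment w r c i)
        ≈⟨ ×-congʳ (factorials r′ ℕ.* factorials c) (sum-moment w r c i) ⟩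
      (factorials r′ ℕ.* factorials c) · (r i · totalWeight F r c w)
        ≈⟨ ×-assocˡ _ (factorials r′ ℕ.* factorials c) (r i) ⟩
      (factorials r′ ℕ.* factorials c ℕ.* r i) · totalWeight F r c w
        ≈⟨ ×-congˡ r!c! ⟩
      (factorials r ℕ.* factorials c) · totalWeight F r c w ∎)
      where
      i  = f zero
      r  = count f
      c  = count g
      r′ = count (f ∘ suc)

      -- The margins of the minor, rewritten to depend on the class `j` rather than the column `q`;
      -- this is what lets `sum-fibres` group the columns by class.
      c⁻ : Fin n → Fin n → ℕ
      c⁻ j l = c l ∸ δ j l

      -- As `i` is the class of the first row, `r k` unfolds to `δ i k ℕ.+ r′ k`.
      r!c! : factorials r′ ℕ.* factorials c ℕ.* r i ≡ factorials r ℕ.* factorials c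
      r!c! = ≡.trans (ℕ.*-comm (factorials r′ ℕ.* factorials c) (r i))
        (≡.trans (≡.sym (ℕ.*-assoc (r i) (factorials r′) (factorials c)))
          (≡.cong (ℕ._* factorials c) (≡.sym (≡.trans (factorials-increment i r′)
            (≡.cong (λ d → (d ℕ.+ r′ i) ℕ.* factorials r′) (≡.sym (δ-refl i)))))))

      summand : ∀ q → w i (g q) * ((factorials r′ ℕ.* factorials (count (g ∘ punchIn q))) ·
                                   totalWeight F r′ (count (g ∘ punchIn q)) w) ≈
                      (factorials r′ ℕ.* factorials (c⁻ (g q))) · moment w r c i (g q)
      summand q = begin
        w i (g q) * ((factorials r′ ℕ.* factorials c′) · totalWeight F r′ c′ w)
          ≈⟨ ×-comm-* (factorials r′ ℕ.* factorials c′) _ _ ⟩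
        (factorials r′ ℕ.* factorials c′) · (w i (g q) * totalWeight F r′ c′ w)
          ≈⟨ ×-congʳ (factorials r′ ℕ.* factorials c′) (moment-increment w r′ c′ i (g q)) ⟨
        (factorials r′ ℕ.* factorials c′) · moment w r (λ l → δ (g q) l ℕ.+ c′ l) i (g q)
          ≈⟨ ×-cong (≡.cong (factorials r′ ℕ.*_) (factorials-cong c′≗c⁻))
                    (moment-cong w (λ _ → refl) (λ l → ≡.sym (count-punchIn g q l)) i (g q)) ⟩
        (factorials r′ ℕ.* factorials (c⁻ (g q))) · moment w r c i (g q) ∎
        where
        c′ = count (g ∘ punchIn q)

        c′≗c⁻ : c′ ≗ c⁻ (g q)
        c′≗c⁻ l = ≡.sym (≡.trans (≡.cong (_∸ δ (g q) l) (count-punchIn g q l)) (ℕ.m+n∸m≡n (δ (g q) l) (c′ l)))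

      -- If c j = 0 then c⁻ j truncates, but the moment vanishes.
      absorb : ∀ j → c j · ((factorials r′ ℕ.* factorials (c⁻ j)) · moment w r c i j) ≈
                     (factorials r′ ℕ.* factorials c) · moment w r c i j
      absorb j with c j ℕ.≟ 0
      ... | yes z = begin
        c j · ((factorials r′ ℕ.* factorials (c⁻ j)) · moment w r c i j)   ≈⟨ ×-congˡ z ⟩
        0#                                                                ≈⟨ ×-zeroʳ (factorials r′ ℕ.* factorials c) ⟨
        (factorials r′ ℕ.* factorials c) · 0#                             ≈⟨ ×-congʳ (factorials r′ ℕ.* factorials c) (moment-zero w i j z) ⟨
        (factorials r′ ℕ.* factorials c) · moment w r c i j               ∎
      ... | no nz = ≈-trans (×-assocˡ _ (c j) (factorials r′ ℕ.* factorials (c⁻ j))) (×-congˡ eq)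
        where
        -- Here `c j` is nonzero, so the subtraction in `c⁻ j` is exact and `factorials-increment`
        -- yields the factor `c j`.
        c≗ : c ≗ (λ l → δ j l ℕ.+ c⁻ j l)
        c≗ l = ≡.sym (ℕ.m+[n∸m]≡n (δ≤ c nz l))

        c! : factorials c ≡ c j ℕ.* factorials (c⁻ j)
        c! = ≡.trans (factorials-cong c≗) (≡.trans (factorials-increment j (c⁻ j))
          (≡.cong (ℕ._* factorials (c⁻ j)) (≡.trans (≡.cong (ℕ._+ c⁻ j j) (≡.sym (δ-refl j))) (≡.sym (c≗ j)))))

        eq : c j ℕ.* (factorials r′ ℕ.* factorials (c⁻ j)) ≡ factorials r′ ℕ.* factorials c
        eq = ≡.trans (ℕ*.x∙yz≈y∙xz (c j) (factorials r′) _) (≡.cong (factorials r′ ℕ.*_) (≡.sym c!))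

-- The identity for a matrix given by blocks

theorem1p7 : ∀ {a ℓ₁ ℓ₂ ℓ₃} (F : OrderedField a ℓ₁ ℓ₂ ℓ₃) → let open OrderedField F in
    ∀ (m n N : ℕ) (r : Fin m → ℕ) (c : Fin n → ℕ) →
    (∀ i → 0 ℕ.< r i) → (∀ j → 0 ℕ.< c j) →
    sumℕ r ≡ N → sumℕ c ≡ N →
    (w : Fin m → Fin n → Carrier) → (∀ i j → 0# ≤ w i j) →
    (R : Fin m → Subset N) → IsDisjointUnion R → (∀ i → ∣ R i ∣ ≡ r i) →
    (C : Fin n → Subset N) → IsDisjointUnion C → (∀ j → ∣ C j ∣ ≡ c j) →
    (A : Fin N → Fin N → Carrier) →
    (∀ i j p q → p ∈ R i → q ∈ C j → A p q ≈ w i j) →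
    totalWeight F r c w ≈ (per F A /ℕ (factorials r ℕ.* factorials c)) {{factorials*factorials≢0 r c}}
theorem1p7 F m n N r c _ _ _ _ w _ R R-union ∣R∣≡r C C-union ∣C∣≡c A A≈w =
  /ℕ-unique F (factorials r ℕ.* factorials c) {{factorials*factorials≢0 r c}} (begin
    (factorials r ℕ.* factorials c) · totalWeight F r c w
      ≈⟨ ×-cong (≡.cong₂ ℕ._*_ (factorials-cong r≗) (factorials-cong c≗)) (totalWeight-cong F w r≗ c≗) ⟩
    (factorials (count f) ℕ.* factorials (count g)) · totalWeight F (count f) (count g) w
      ≈⟨ factorials*totalWeight≈per F w f g ⟩
    per F (λ p q → w (f p) (g q))
      ≈⟨ per-cong F (λ p q → A≈w (f p) (g q) p q (∈-part R-union p) (∈-part C-union q)) ⟨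
    per F A ∎)
  where
  open OrderedField F using (setoid; semiring; _·_)
  open SemiringMult semiring using (×-cong)
  open SetoidReasoning setoid

  -- The blocks containing a given row and column; their fibre sizes are the prescribed margins, so
  -- `A` becomes the matrix of the induction.
  f = part R-union
  g = part C-union

  r≗ : r ≗ count f
  r≗ i = ≡.sym (≡.trans (count-part R-union i) (∣R∣≡r i))

  c≗ : c ≗ count g
  c≗ j = ≡.sym (≡.trans (count-part C-union j) (∣C∣≡c j))
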